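{- Let $G$ be a finite path graph. Then for every starting vertex $v$ of $G$ the Explorer has a nonadaptive strategy that visits each vertex exactly once, regardless of the Director's choices; that is, there is a finite sequence $S$ of distances such that, when the Explorer calls the entries of $S$ in order starting with the token at $v$, for every possible play of the Director the token occupies each vertex of $G$ exactly once (counting the initial position $v$).
   Context: Explorer-Director game on a connected graph $G$ with starting vertex $v$: a token is initially at $v$ (so $v$ counts as visited). On each turn the Explorer names a distance $d$ such that at least one vertex of $G$ is at (shortest-path) distance exactly $d$ from the token's current position, and then the Director moves the token to a vertex of their choice at distance exactly $d$ from the current position. A nonadaptive strategy is a finite sequence of natural numbers, fixed in advance, which the Explorer calls in order regardless of the Director's choices (each call must be a legal move whatever the Director has done before). -}

module Defs where

open import Data.Fin.Base using (Fin; toℕ)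
open import Data.List.Base using (List; []; _∷_; length; lookup)
open import Data.Nat.Base using (ℕ; zero; suc; _≤_)
open import Data.Nat.Properties using (1+n≢n)
open import Data.Product using (_×_; ∃-syntax; ∃!)
open import Data.Sum.Base using (_⊎_; swap; [_,_]′)
open import Function.Base using (_∘_)
open import Relation.Binary.Core using (Rel)
open import Relation.Binary.Definitions using (Symmetric; Irreflexive)
open import Relation.Binary.PropositionalEquality using (_≡_; refl; sym)
open import Level using (0ℓ)

record SimpleGraph : Set₁ where
  field
    Vertex   : Set
    Adj      : Rel Vertex 0ℓ
    Adj-sym  : Symmetric Adj
    Adj-irr  : Irreflexive _≡_ Adj

open SimpleGraph public

-- The vertices 0, …, n - 1 in order along the path.
pathGraph : ℕ → SimpleGraph
pathGraph n = record
  { Vertex  = Fin n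
  ; Adj     = λ i j → toℕ j ≡ suc (toℕ i) ⊎ toℕ i ≡ suc (toℕ j)
  ; Adj-sym = swap
  ; Adj-irr = λ { refl → [ 1+n≢n ∘ sym , 1+n≢n ∘ sym ]′ }
  }

module _ (G : SimpleGraph) where

  -- Walk u w k: walks from u to w with k edges.
  data Walk : Vertex G → Vertex G → ℕ → Set where
    nil  : ∀ {u} → Walk u u zero
    cons : ∀ {u v w k} → Adj G u v → Walk v w k → Walk u w (suc k)

  -- Shortest-path distance, as a relation: the distance from u to w is d.
  Distance : Vertex G → Vertex G → ℕ → Set
  Distance u w d = Walk u w d × (∀ k → Walk u w k → d ≤ k)

  -- Every call is legal whatever the Director has done before: some vertex is
  -- at the called distance, and the remaining calls are legal after each
  -- possible reply.
  data AlwaysLegal : Vertex G → List ℕ → Set where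
    stop : ∀ {u} → AlwaysLegal u []
    call : ∀ {u d S} →
           ∃[ w ] Distance u w d →
           (∀ w → Distance u w d → AlwaysLegal w S) →
           AlwaysLegal u (d ∷ S)

  -- Play u S ps: when the calls S are made with the token at u, the Director
  -- can move so that its successive positions, u included, are ps.
  data Play : Vertex G → List ℕ → List (Vertex G) → Set where
    stop : ∀ {u} → Play u [] (u ∷ [])
    move : ∀ {u w d S ps} →
           Distance u w d → Play w S ps → Play u (d ∷ S) (u ∷ ps)

  VisitsEachOnce : List (Vertex G) → Set
  VisitsEachOnce ps =
    ∀ (x : Vertex G) → ∃! _≡_ (λ (t : Fin (length ps)) → lookup ps t ≡ x)

{-# OPTIONS --safe #-}
-- Number the vertices 0, …, n - 1.  A call that would leave the path on one side
-- is forced: from u every w > 2 u and every w ≤ 2 u - n can be prescribed.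
-- For n = 2 m the perfect shuffle x ↦ 2 x + 1, m + x ↦ 2 x (x < m) consists of forced
-- moves, and each of its orbits contains a vertex ≥ m.  Starting from the orbit of 0 we
-- splice in the others in the order of their least vertex z ≥ m: both 0 → w (w > 0)
-- and z → w with w ≤ 2 (z - m) are forced.  This gives a Hamiltonian cycle of forced
-- moves.  If the shuffle is first modified so that 2 m - 1 is sent to a given v with
-- m ≤ v ≤ 2 m - 2, the cycle is a forced Hamiltonian path from v to 2 m - 1.
-- For n = 2 m + 1, forced moves on 2 m vertices remain forced when a centre is inserted,
-- and from the end the centre can be reached last; a start left of the centre is mirrored,
-- and the zigzag 0, m + 1, 1, m + 2, …, 2 m serves for an end vertex.  From the centre,
-- the call m leads to one of the ends, and the calls of the zigzag visit the rest from either.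
module Submission where

open import Data.Empty using (⊥)
open import Data.Fin.Base as Fin using (Fin; toℕ; fromℕ<; opposite; combine; cast; punchIn; punchOut)
open import Data.Fin.Patterns using (0F; 1F)
open import Data.Fin.Permutation
  using (Permutation′; _⟨$⟩ʳ_; _⟨$⟩ˡ_; inverseˡ; inverseʳ; transpose; _∘ₚ_; cast-id)
open import Data.Fin.Properties
  using ( toℕ-injective; toℕ<n; toℕ-fromℕ; toℕ-fromℕ<; toℕ-cast; _≟_; injective⇒≤
        ; *↔×; combine-surjective; remQuot-combine; toℕ-combine
        ; opposite-prop; opposite-involutive; punchIn-injective; punchInᵢ≢i; punchIn-punchOut )
open import Data.List.Base using (List; []; _∷_; _++_; length; lookup; map)
open import Data.List.Membership.DecPropositional using (_∈?_)
open import Data.List.Membership.Propositional using (_∈_; _∉_)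
open import Data.List.Membership.Propositional.Properties
  using (∈-lookup; ∈-++⁺ˡ; ∈-++⁺ʳ; ∈-++⁻; ∈-map⁺; ∈-map⁻)
open import Data.List.Relation.Binary.Disjoint.Propositional using (Disjoint)
open import Data.List.Relation.Binary.Permutation.Propositional using (↭⇒↭ₛ)
open import Data.List.Relation.Binary.Permutation.Propositional.Properties using (++-comm)
import Data.List.Relation.Binary.Permutation.Setoid.Properties as Permutationₛ
open import Data.List.Relation.Unary.All as All using (All)
open import Data.List.Relation.Unary.All.Properties using (¬Any⇒All¬)
open import Data.List.Relation.Unary.AllPairs using ([]; _∷_)
open import Data.List.Relation.Unary.Any as Any using (here; there)
open import Data.List.Relation.Unary.Any.Properties using (lookup-index)
open import Data.List.Relation.Unary.Unique.Propositional using (Unique)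
import Data.List.Relation.Unary.Unique.Propositional.Properties as Unique
open import Data.Nat.Base
open import Data.Nat.Properties hiding (_≟_)
open import Data.Nat.Tactic.RingSolver using (solve-∀)
open import Data.Product using (_×_; _,_; ∃-syntax; proj₁; proj₂)
open import Data.Sum.Base using (_⊎_; inj₁; inj₂)
open import Function.Base using (_∘_)
open import Function.Bundles using (_↔_; mk↔ₛ′)
open import Function.Properties.Inverse using (↔-sym; ↔-trans)
open import Relation.Binary.Definitions using (tri<; tri≈; tri>)
open import Relation.Binary.PropositionalEquality
open import Relation.Nullary using (yes; no; contradiction)
open import Defs

-- Repetition-free lists and distances on the path.

lookup-injective : ∀ {A : Set} {xs : List A} → Unique xs →
                   ∀ i j → lookup xs i ≡ lookup xs j → i ≡ j
lookup-injective (_ ∷ _)   Fin.zero    Fin.zero    _  = refl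
lookup-injective (x≢ ∷ _)  Fin.zero    (Fin.suc j) eq = contradiction eq (All.lookup x≢ (∈-lookup j))
lookup-injective (x≢ ∷ _)  (Fin.suc i) Fin.zero    eq = contradiction (sym eq) (All.lookup x≢ (∈-lookup i))
lookup-injective (_ ∷ xs!) (Fin.suc i) (Fin.suc j) eq = cong Fin.suc (lookup-injective xs! i j eq)

module _ {n : ℕ} where

  visitsEachOnce : ∀ {ps} → Unique ps → (∀ x → x ∈ ps) → VisitsEachOnce (pathGraph n) ps
  visitsEachOnce ps! all x =
    Any.index (all x) , sym (lookup-index (all x)) ,
    λ eq → lookup-injective ps! _ _ (trans (sym (lookup-index (all x))) (sym eq))

  dist : Fin n → Fin n → ℕ
  dist u w = ∣ toℕ u - toℕ w ∣

  dist≤walk : ∀ {u w k} → Walk (pathGraph n) u w k → dist u w ≤ k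
  dist≤walk {u} nil = ≤-reflexive (∣n-n∣≡0 (toℕ u))
  dist≤walk {u} {w} (cons {v = v} adj walk) =
    ≤-trans (∣-∣-triangle (toℕ u) (toℕ v) (toℕ w)) (+-mono-≤ (step adj) (dist≤walk walk))
    where
    step : Adj (pathGraph n) u v → dist u v ≤ 1
    step (inj₁ eq) rewrite eq = ≤-reflexive (trans (cong ∣ toℕ u -_∣ (+-comm 1 (toℕ u))) (∣m-m+n∣≡n (toℕ u) 1))
    step (inj₂ eq) rewrite eq = ≤-reflexive (trans (∣-∣-comm (suc (toℕ v)) (toℕ v))
                                  (trans (cong ∣ toℕ v -_∣ (+-comm 1 (toℕ v))) (∣m-m+n∣≡n (toℕ v) 1)))

  walkʳ : ∀ k {u w} → toℕ w ≡ k + toℕ u → Walk (pathGraph n) u w k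
  walkʳ zero    eq rewrite toℕ-injective eq = nil
  walkʳ (suc k) {u} {w} eq =
    cons (inj₁ (toℕ-fromℕ< u+1<n))
      (walkʳ k (trans eq (trans (sym (+-suc k (toℕ u))) (cong (k +_) (sym (toℕ-fromℕ< u+1<n))))))
    where
    u+1<n : suc (toℕ u) < n
    u+1<n = ≤-<-trans (≤-trans (s≤s (m≤n+m (toℕ u) k)) (≤-reflexive (sym eq))) (toℕ<n w)

  walkˡ : ∀ k {u w} → toℕ u ≡ k + toℕ w → Walk (pathGraph n) u w k
  walkˡ zero    eq rewrite toℕ-injective eq = nil
  walkˡ (suc k) {u} {w} eq =
    cons (inj₂ (trans eq (cong suc (sym (toℕ-fromℕ< k+w<n))))) (walkˡ k (toℕ-fromℕ< k+w<n))
    where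
    k+w<n : k + toℕ w < n
    k+w<n = <-trans (≤-reflexive (sym eq)) (toℕ<n u)

  walk : ∀ u w → Walk (pathGraph n) u w (dist u w)
  walk u w with ≤-total (toℕ u) (toℕ w)
  ... | inj₁ u≤w rewrite m≤n⇒∣m-n∣≡n∸m u≤w = walkʳ _ (sym (m∸n+n≡m u≤w))
  ... | inj₂ w≤u rewrite m≤n⇒∣n-m∣≡n∸m w≤u = walkˡ _ (sym (m∸n+n≡m w≤u))

  distance : ∀ u w → Distance (pathGraph n) u w (dist u w)
  distance u w = walk u w , λ _ → dist≤walk

  distance⇒≡ : ∀ {u w d} → Distance (pathGraph n) u w d → d ≡ dist u w
  distance⇒≡ (p , shortest) = ≤-antisym (shortest _ (walk _ _)) (dist≤walk p)

-- Forced moves and the plays they determine.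

-- The move from u to w is so long that the point at the same distance on the
-- other side of u lies off the path.
Forced : ℕ → ℕ → ℕ → Set
Forced n u w = u + u < w ⊎ w + n ≤ u + u

-- The only other candidate at the same distance from `u` is 2 u - w, which is negative in the first
-- case and at least n in the second.
forced-unique : ∀ {n u w x} → u < n → x < n → Forced n u w → ∣ u - x ∣ ≡ ∣ u - w ∣ → x ≡ w
forced-unique {n} {u} {w} {x} u<n x<n (inj₁ 2u<w) eq with ≤-total x u
... | inj₁ x≤u = contradiction (≤-trans (≤-reflexive lem) (m∸n≤m u x)) (<⇒≱ (m+n≤o⇒m≤o∸n (suc u) 2u<w))
  where
  lem : w ∸ u ≡ u ∸ x
  lem = trans (sym (m≤n⇒∣m-n∣≡n∸m (≤-trans (m≤m+n u u) (<⇒≤ 2u<w)))) (trans (sym eq) (m≤n⇒∣n-m∣≡n∸m x≤u))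
... | inj₂ u≤x = ∸-cancelʳ-≡ u≤x u≤w (trans (sym (m≤n⇒∣m-n∣≡n∸m u≤x)) (trans eq (m≤n⇒∣m-n∣≡n∸m u≤w)))
  where
  u≤w : u ≤ w
  u≤w = ≤-trans (m≤m+n u u) (<⇒≤ 2u<w)
forced-unique {n} {u} {w} {x} u<n x<n (inj₂ w+n≤2u) eq with ≤-total x u
... | inj₁ x≤u = ∸-cancelˡ-≡ x≤u w≤u (trans (sym (m≤n⇒∣n-m∣≡n∸m x≤u)) (trans eq (m≤n⇒∣n-m∣≡n∸m w≤u)))
  where
  w≤u : w ≤ u
  w≤u = +-cancelʳ-≤ u w u (≤-trans (+-monoʳ-≤ w (<⇒≤ u<n)) w+n≤2u)
... | inj₂ u≤x = contradiction x<n (≤⇒≯ (+-cancelˡ-≤ w n x (≤-trans w+n≤2u (≤-reflexive 2u≡w+x))))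
  where
  w≤u : w ≤ u
  w≤u = +-cancelʳ-≤ u w u (≤-trans (+-monoʳ-≤ w (<⇒≤ u<n)) w+n≤2u)
  x∸u≡u∸w : x ∸ u ≡ u ∸ w
  x∸u≡u∸w = trans (sym (m≤n⇒∣m-n∣≡n∸m u≤x)) (trans eq (m≤n⇒∣n-m∣≡n∸m w≤u))
  2u≡w+x : u + u ≡ w + x
  2u≡w+x = begin
    u + u             ≡⟨ cong (_+ u) (m+[n∸m]≡n w≤u) ⟨
    w + (u ∸ w) + u   ≡⟨ +-assoc w _ u ⟩
    w + (u ∸ w + u)   ≡⟨ cong (λ k → w + (k + u)) x∸u≡u∸w ⟨
    w + (x ∸ u + u)   ≡⟨ cong (w +_) (m∸n+n≡m u≤x) ⟩
    w + x             ∎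
    where open ≡-Reasoning

-- The list of vertices is an index, so that repetition and coverage can be discussed on a plain
-- list and `calls` can read the distances off it.
data Path {V : Set} (R : V → V → Set) : V → V → List V → Set where
  [_] : ∀ x → Path R x x (x ∷ [])
  _∷_ : ∀ {x y z l} → R x y → Path R y z l → Path R x z (x ∷ l)

ForcedMove : ∀ {n} → Fin n → Fin n → Set
ForcedMove {n} u w = Forced n (toℕ u) (toℕ w)

calls : ∀ {n} → List (Fin n) → List ℕ
calls (x ∷ y ∷ l) = dist x y ∷ calls (y ∷ l)
calls _           = []

module _ {n : ℕ} where

  reply-unique : ∀ {u w x d} → ForcedMove {n} u w → d ≡ dist u w → Distance (pathGraph n) u x d → x ≡ w
  reply-unique {u} {x = x} e refl D = toℕ-injective (forced-unique (toℕ<n u) (toℕ<n x) e (sym (distance⇒≡ D)))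

  -- By `reply-unique` each call leaves the Director a single reply, so the token can only follow
  -- the path.
  alwaysLegal : ∀ {u z l} → Path ForcedMove u z l → AlwaysLegal (pathGraph n) u (calls l)
  alwaysLegal [ _ ] = stop
  -- The rest of the path is split because `calls` reduces only once two vertices of the list are
  -- exposed.
  alwaysLegal (e ∷ [ y ]) = call (y , distance _ y) (λ w D → stop)
  alwaysLegal {u} (e ∷ p@(_∷_ {x = y} _ _)) = call (y , distance _ y)
    λ w D → subst (λ w → AlwaysLegal (pathGraph n) w _) (sym (reply-unique e refl D)) (alwaysLegal p)

  play-unique : ∀ {u z l ps} → Path ForcedMove u z l → Play (pathGraph n) u (calls l) ps → ps ≡ l
  play-unique [ _ ] stop = refl
  play-unique (e ∷ p@([ y ])) (move D q) with refl ← reply-unique e refl D = cong (_ ∷_) (play-unique p q)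
  play-unique (e ∷ p@(_ ∷ _)) (move D q) with refl ← reply-unique e refl D = cong (_ ∷_) (play-unique p q)

-- Cutting and joining paths.

module _ {V : Set} {R : V → V → Set} where

  start∈ : ∀ {x z l} → Path R x z l → x ∈ l
  start∈ [ _ ]   = here refl
  start∈ (_ ∷ _) = here refl

  end∈ : ∀ {x z l} → Path R x z l → z ∈ l
  end∈ [ _ ]   = here refl
  end∈ (_ ∷ p) = there (end∈ p)

  join : ∀ {w x y z k l} → Path R w x k → R x y → Path R y z l → Path R w z (k ++ l)
  join [ _ ]   r q = r ∷ q
  join (s ∷ p) r q = s ∷ join p r q

  -- For opening a cycle at `v`: the edge into `v` is dropped, and the two pieces can be rejoined in
  -- the other order by the edge that closes the cycle.
  split : ∀ {v x z l} → Path R x z l → v ∈ l →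
          x ≡ v ⊎ ∃[ y ] ∃[ k ] ∃[ k′ ] (Path R x y k × R y v × Path R v z k′ × l ≡ k ++ k′)
  split [ _ ]   (here eq)   = inj₁ (sym eq)
  split (r ∷ p) (here eq)   = inj₁ (sym eq)
  split {x = x} (r ∷ p) (there v∈) with split p v∈
  ... | inj₁ refl = inj₂ (_ , _ , _ , [ x ] , r , p , refl)
  ... | inj₂ (y , k , k′ , q , s , q′ , refl) = inj₂ (y , x ∷ k , k′ , r ∷ q , s , q′ , refl)

map-path : ∀ {V W : Set} {R : V → V → Set} {S : W → W → Set} (f : V → W) →
           (∀ {x y} → R x y → S (f x) (f y)) →
           ∀ {x z l} → Path R x z l → Path S (f x) (f z) (map f l)
map-path f m [ x ]   = [ f x ]
map-path f m (r ∷ p) = m r ∷ map-path f m p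

unique-++-comm : ∀ {A : Set} (k : List A) {l} → Unique (k ++ l) → Unique (l ++ k)
unique-++-comm k {l} = Permutationₛ.Unique-resp-↭ (setoid _) (↭⇒↭ₛ (++-comm k l))

unique-length : ∀ {n} {l : List (Fin n)} → Unique l → length l ≤ n
unique-length l! = injective⇒≤ (lookup-injective l! _ _)

-- Orbits of a permutation as paths.

module Orbits {n : ℕ} (π : Permutation′ n) (R : Fin n → Fin n → Set)
              (R-π : ∀ x → R x (π ⟨$⟩ʳ x)) where

  -- Recording both directions spares a counting argument: the forward one keeps a new orbit
  -- disjoint from `K`, the backward one recovers a vertex from its image.
  Closed : List (Fin n) → Set
  Closed l = (∀ {x} → x ∈ l → π ⟨$⟩ʳ x ∈ l) × (∀ {x} → π ⟨$⟩ʳ x ∈ l → x ∈ l)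

  π-injective : ∀ {x y} → π ⟨$⟩ʳ x ≡ π ⟨$⟩ʳ y → x ≡ y
  π-injective eq = trans (sym (inverseˡ π)) (trans (cong (π ⟨$⟩ˡ_) eq) (inverseˡ π))

  module _ {K : List (Fin n)} (K-closed : Closed K) (a : Fin n) where

    -- l ends in a and is traversed by π; the fuel f cannot run out since l has no repetition.
    grow : ∀ f {x l} → length l + f ≡ suc n →
           Path R x a l → Unique l → Disjoint l K →
           (∀ {y} → y ∈ l → y ≡ a ⊎ (π ⟨$⟩ʳ y ∈ l × π ⟨$⟩ʳ y ≢ x)) →
           (∀ {y} → π ⟨$⟩ʳ y ∈ l → y ∈ l ⊎ π ⟨$⟩ʳ y ≡ x) →
           ∃[ b ] (Path R (π ⟨$⟩ʳ a) a b × Unique b × Disjoint b K × Closed b)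
    grow zero eq _ l! _ _ _ =
      contradiction (unique-length l!) (<⇒≱ (≤-reflexive (trans (sym eq) (+-identityʳ _))))
    grow (suc f) {x} {l} eq p l! l#K fwd bwd with _∈?_ _≟_ (π ⟨$⟩ˡ x) l
    -- The list grows at the front by the preimage of `x`. By `fwd` no vertex of `l` except `a` can
    -- be sent to `x`, so a preimage already in `l` is `a` and the orbit has closed up.
    ... | yes r∈l with fwd r∈l
    ...   | inj₂ (_ , πr≢x) = contradiction (inverseʳ π) πr≢x
    ...   | inj₁ r≡a = l , subst (λ y → Path R y a l) (sym πa≡x) p , l! , l#K , closed₁ , closed₂
      where
      πa≡x : π ⟨$⟩ʳ a ≡ x
      πa≡x = trans (cong (π ⟨$⟩ʳ_) (sym r≡a)) (inverseʳ π)
      closed₁ : ∀ {y} → y ∈ l → π ⟨$⟩ʳ y ∈ l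
      closed₁ y∈l with fwd y∈l
      ... | inj₁ refl = subst (_∈ l) (sym πa≡x) (start∈ p)
      ... | inj₂ (πy∈l , _) = πy∈l
      closed₂ : ∀ {y} → π ⟨$⟩ʳ y ∈ l → y ∈ l
      closed₂ πy∈l with bwd πy∈l
      ... | inj₁ y∈l = y∈l
      ... | inj₂ πy≡x = subst (_∈ l) (π-injective (trans πa≡x (sym πy≡x))) (end∈ p)
    grow (suc f) {x} {l} eq p l! l#K fwd bwd | no r∉l =
      grow f (trans (sym (+-suc (length l) f)) eq)
        (subst (R r) (inverseʳ π) (R-π r) ∷ p) (¬Any⇒All¬ l r∉l ∷ l!) disjoint fwd′ bwd′
      where
      r : Fin n
      r = π ⟨$⟩ˡ x
      disjoint : Disjoint (r ∷ l) K
      disjoint (here refl , r∈K) = l#K (start∈ p , subst (_∈ K) (inverseʳ π) (proj₁ K-closed r∈K))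
      disjoint (there y∈l , y∈K) = l#K (y∈l , y∈K)
      fwd′ : ∀ {y} → y ∈ r ∷ l → y ≡ a ⊎ (π ⟨$⟩ʳ y ∈ r ∷ l × π ⟨$⟩ʳ y ≢ r)
      fwd′ (here refl) = inj₂ (subst (_∈ r ∷ l) (sym (inverseʳ π)) (there (start∈ p)) ,
                               λ πr≡r → r∉l (subst (_∈ l) (trans (sym (inverseʳ π)) πr≡r) (start∈ p)))
      fwd′ (there y∈l) with fwd y∈l
      ... | inj₁ y≡a = inj₁ y≡a
      ... | inj₂ (πy∈l , _) = inj₂ (there πy∈l , λ πy≡r → r∉l (subst (_∈ l) πy≡r πy∈l))
      bwd′ : ∀ {y} → π ⟨$⟩ʳ y ∈ r ∷ l → y ∈ r ∷ l ⊎ π ⟨$⟩ʳ y ≡ r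
      bwd′ (here πy≡r) = inj₂ πy≡r
      bwd′ (there πy∈l) with bwd πy∈l
      ... | inj₁ y∈l = inj₁ (there y∈l)
      ... | inj₂ πy≡x = inj₁ (here (π-injective (trans πy≡x (sym (inverseʳ π)))))

    -- The orbit is cut open at the edge from `a` to its image, which leaves `a` at the end, free to
    -- be sent elsewhere.
    orbit : a ∉ K → ∃[ b ] (Path R (π ⟨$⟩ʳ a) a b × Unique b × Disjoint b K × Closed b)
    orbit a∉K = grow n refl [ a ] (All.[] ∷ []) (λ { (here refl , a∈K) → a∉K a∈K })
                  (λ { (here y≡a) → inj₁ y≡a }) (λ { (here πy≡a) → inj₂ πy≡a })

  -- The orbit of z is put in front of a path, the edge z → π z being replaced by z → h.
  absorb : ∀ {h c z K} → Path R h c K → Unique K → Closed K → z ∉ K → R z h →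
           ∃[ K′ ] (Path R (π ⟨$⟩ʳ z) c K′ × Unique K′ × Closed K′ × z ∈ K′ × (∀ {x} → x ∈ K → x ∈ K′))
  absorb {K = K} p K! K-closed@(K₁ , K₂) z∉K r with orbit K-closed _ z∉K
  ... | b , q , b! , b#K , b₁ , b₂ =
    b ++ K , join q r p , Unique.++⁺ b! K! b#K , (closed₁ , closed₂) , ∈-++⁺ˡ (end∈ q) , ∈-++⁺ʳ b
    where
    closed₁ : ∀ {x} → x ∈ b ++ K → π ⟨$⟩ʳ x ∈ b ++ K
    closed₁ x∈ with ∈-++⁻ b x∈
    ... | inj₁ x∈b = ∈-++⁺ˡ (b₁ x∈b)
    ... | inj₂ x∈K = ∈-++⁺ʳ b (K₁ x∈K)
    closed₂ : ∀ {x} → π ⟨$⟩ʳ x ∈ b ++ K → x ∈ b ++ K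
    closed₂ x∈ with ∈-++⁻ b x∈
    ... | inj₁ x∈b = ∈-++⁺ˡ (b₂ x∈b)
    ... | inj₂ x∈K = ∈-++⁺ʳ b (K₂ x∈K)

halve : ∀ n → ∃[ m ] (n ≡ m + m ⊎ n ≡ suc (m + m))
halve zero = 0 , inj₁ refl
halve (suc n) with halve n
... | m , inj₁ refl = m , inj₂ refl
... | m , inj₂ refl = suc m , inj₁ (cong suc (sym (+-suc m m)))

weaken : ∀ {V : Set} {R S : V → V → Set} → (∀ {x y} → R x y → S x y) →
         ∀ {x z l} → Path R x z l → Path S x z l
weaken f [ x ]   = [ x ]
weaken f (r ∷ p) = f r ∷ weaken f p

Hamiltonian : ∀ {n} → Fin n → Fin n → Set
Hamiltonian v z = ∃[ l ] (Path ForcedMove v z l × Unique l × (∀ x → x ∈ l))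

rotate-all : ∀ {A : Set} (k : List A) {l x} → x ∈ k ++ l → x ∈ l ++ k
rotate-all k {l} x∈ with ∈-++⁻ k x∈
... | inj₁ x∈k = ∈-++⁺ʳ l x∈k
... | inj₂ x∈l = ∈-++⁺ˡ x∈l

-- The perfect shuffle and exchanges of images.

-- The perfect shuffle x ↦ 2 x + 1, m + x ↦ 2 x (x < m).
shuffle : ∀ m → Permutation′ (m + m)
shuffle m =
  ↔-trans (cast-id (cong (m +_) (sym (+-identityʳ m))))
  (↔-trans *↔×
  (↔-trans exchange
  (↔-trans (↔-sym *↔×)
           (cast-id (trans (*-comm m 2) (cong (m +_) (+-identityʳ m)))))))
  where
  -- The vertex b m + i with i < m is coded by (b , i); it becomes 2 i + (1 - b), coded by (i , 1 -
  -- b).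
  exchange : (Fin 2 × Fin m) ↔ (Fin m × Fin 2)
  exchange = mk↔ₛ′ (λ (b , i) → i , opposite b) (λ (i , b) → opposite b , i)
                   (λ (i , b) → cong (i ,_) (opposite-involutive b))
                   (λ (b , i) → cong (_, i) (opposite-involutive b))

shuffle-view : ∀ m (x : Fin (m + m)) → ∃[ i ]
  ((toℕ x ≡ i × i < m × toℕ (shuffle m ⟨$⟩ʳ x) ≡ suc (i + i)) ⊎
   (toℕ x ≡ m + i × toℕ (shuffle m ⟨$⟩ʳ x) ≡ i + i))
shuffle-view m x with combine-surjective {2} {m} (cast (cong (m +_) (sym (+-identityʳ m))) x)
... | b , i , eq = toℕ i , lemma b eq
  where
  x≡ : ∀ (b : Fin 2) → combine b i ≡ cast (cong (m +_) (sym (+-identityʳ m))) x → toℕ x ≡ m * toℕ b + toℕ i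
  x≡ b eq = trans (sym (toℕ-cast _ x)) (trans (cong toℕ (sym eq)) (toℕ-combine b i))
  πx≡ : ∀ (b : Fin 2) → combine b i ≡ cast (cong (m +_) (sym (+-identityʳ m))) x →
        toℕ (shuffle m ⟨$⟩ʳ x) ≡ 2 * toℕ i + toℕ (opposite b)
  πx≡ b eq = trans (toℕ-cast _ _) (trans
    (cong (λ y → toℕ (combine (proj₂ (Fin.remQuot {2} m y)) (opposite (proj₁ (Fin.remQuot {2} m y)))))
      (sym eq))
    (trans (cong (λ (c , j) → toℕ (combine j (opposite c))) (remQuot-combine {2} {m} b i))
      (toℕ-combine i (opposite b))))
  lemma : ∀ (b : Fin 2) → combine b i ≡ cast (cong (m +_) (sym (+-identityʳ m))) x →
    ((toℕ x ≡ toℕ i × toℕ i < m × toℕ (shuffle m ⟨$⟩ʳ x) ≡ suc (toℕ i + toℕ i)) ⊎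
     (toℕ x ≡ m + toℕ i × toℕ (shuffle m ⟨$⟩ʳ x) ≡ toℕ i + toℕ i))
  lemma 0F eq = inj₁ (trans (x≡ 0F eq) (cong (_+ toℕ i) (*-zeroʳ m)) , toℕ<n i ,
                      trans (πx≡ 0F eq) (double+1 (toℕ i)))
    where
    double+1 : ∀ i → 2 * i + 1 ≡ suc (i + i)
    double+1 = solve-∀
  lemma 1F eq = inj₂ (trans (x≡ 1F eq) (cong (_+ toℕ i) (*-identityʳ m)) ,
                      trans (πx≡ 1F eq) (double (toℕ i)))
    where
    double : ∀ i → 2 * i + 0 ≡ i + i
    double = solve-∀

shuffleˡ : ∀ m {x : Fin (m + m)} → toℕ x < m → toℕ (shuffle m ⟨$⟩ʳ x) ≡ suc (toℕ x + toℕ x)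
shuffleˡ m {x} x<m with shuffle-view m x
... | _ , inj₁ (refl , _ , eq) = eq
... | i , inj₂ (x≡ , _) = contradiction x<m (≤⇒≯ (≤-trans (m≤m+n m i) (≤-reflexive (sym x≡))))

shuffleʳ : ∀ m {x : Fin (m + m)} {i} → toℕ x ≡ m + i → toℕ (shuffle m ⟨$⟩ʳ x) ≡ i + i
shuffleʳ m {x} {i} x≡ with shuffle-view m x
... | _ , inj₁ (refl , x<m , _) = contradiction x<m (≤⇒≯ (≤-trans (m≤m+n m i) (≤-reflexive (sym x≡))))
... | j , inj₂ (x≡′ , eq) with refl ← +-cancelˡ-≡ m j i (trans (sym x≡′) x≡) = eq

-- The shuffle makes the shortest forced moves: 2 x + 1 is the least target right of 2 x, and 2 i =
-- 2 (m + i) - 2 m is the greatest target allowed on the left.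
shuffle-forced : ∀ m (x : Fin (m + m)) → ForcedMove x (shuffle m ⟨$⟩ʳ x)
shuffle-forced m x with shuffle-view m x
... | i , inj₁ (refl , _ , eq) = inj₁ (≤-reflexive (sym eq))
... | i , inj₂ (x≡ , eq) = inj₂ (≤-reflexive (trans (cong (_+ (m + m)) eq)
                              (trans (double i m) (sym (cong₂ _+_ x≡ x≡)))))
  where
  double : ∀ i m → i + i + (m + m) ≡ m + i + (m + i)
  double = solve-∀

transpose-view : ∀ {n} (p q x : Fin n) →
  (x ≡ p × transpose p q ⟨$⟩ʳ x ≡ q) ⊎
  (x ≡ q × transpose p q ⟨$⟩ʳ x ≡ p) ⊎
  (x ≢ p × x ≢ q × transpose p q ⟨$⟩ʳ x ≡ x)
transpose-view p q x with x ≟ p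
... | yes x≡p = inj₁ (x≡p , refl)
... | no x≢p with x ≟ q
...   | yes x≡q = inj₂ (inj₁ (x≡q , refl))
...   | no  x≢q = inj₂ (inj₂ (x≢p , x≢q , refl))

transposeʳ : ∀ {n} (p q : Fin n) → transpose p q ⟨$⟩ʳ q ≡ p
transposeʳ p q with transpose-view p q q
... | inj₁ (q≡p , eq) = trans eq q≡p
... | inj₂ (inj₁ (_ , eq)) = eq
... | inj₂ (inj₂ (_ , q≢q , _)) = contradiction refl q≢q

transpose-≢ : ∀ {n} {p q x : Fin n} → x ≢ p → x ≢ q → transpose p q ⟨$⟩ʳ x ≡ x
transpose-≢ {p = p} {q} {x} x≢p x≢q with transpose-view p q x
... | inj₁ (x≡p , _) = contradiction x≡p x≢p
... | inj₂ (inj₁ (x≡q , _)) = contradiction x≡q x≢q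
... | inj₂ (inj₂ (_ , _ , eq)) = eq

-- Orbits are merged at the hub 0, so its own orbit should contain m and leave 0 by the
-- shortest possible move.
record Valid (m : ℕ) (π : Permutation′ (m + m)) : Set where
  field
    forced : ∀ x → ForcedMove x (π ⟨$⟩ʳ x)
    hub    : ∀ x → toℕ x ≡ 0 → toℕ (π ⟨$⟩ʳ x) ≡ 1
    middle : ∀ x → toℕ x ≡ m → toℕ (π ⟨$⟩ʳ x) ≡ 0

shuffle-valid : ∀ m → Valid (suc m) (shuffle (suc m))
shuffle-valid m = record
  { forced = shuffle-forced (suc m)
  ; hub    = λ x x≡0 → trans (shuffleˡ (suc m) (subst (_< suc m) (sym x≡0) z<s))
                        (cong (λ i → suc (i + i)) x≡0)
  ; middle = λ x x≡m → shuffleʳ (suc m) (trans x≡m (sym (+-identityʳ (suc m))))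
  }

-- The transposition acts first, so `p` and `q` exchange their images, while all other vertices, 0
-- and m among them, keep theirs.
transpose-valid : ∀ {m π p q} → Valid m π → ForcedMove p (π ⟨$⟩ʳ q) → ForcedMove q (π ⟨$⟩ʳ p) →
                  toℕ p ≢ 0 → toℕ q ≢ 0 → toℕ p ≢ m → toℕ q ≢ m →
                  Valid m (transpose p q ∘ₚ π)
transpose-valid {m} {π} {p} {q} π-valid pq qp p≢0 q≢0 p≢m q≢m = record
  { forced = forced′
  ; hub    = λ x x≡0 → trans (cong (λ y → toℕ (π ⟨$⟩ʳ y)) (fix (λ { refl → p≢0 x≡0 }) λ { refl → q≢0 x≡0 }))
                        (hub x x≡0)
  ; middle = λ x x≡m → trans (cong (λ y → toℕ (π ⟨$⟩ʳ y)) (fix (λ { refl → p≢m x≡m }) λ { refl → q≢m x≡m }))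
                        (middle x x≡m)
  }
  where
  open Valid π-valid
  fix : ∀ {x} → x ≢ p → x ≢ q → transpose p q ⟨$⟩ʳ x ≡ x
  fix = transpose-≢
  forced′ : ∀ x → ForcedMove x (π ⟨$⟩ʳ (transpose p q ⟨$⟩ʳ x))
  forced′ x with transpose-view p q x
  ... | inj₁ (refl , eq) = subst (λ y → ForcedMove x (π ⟨$⟩ʳ y)) (sym eq) pq
  ... | inj₂ (inj₁ (refl , eq)) = subst (λ y → ForcedMove x (π ⟨$⟩ʳ y)) (sym eq) qp
  ... | inj₂ (inj₂ (_ , _ , eq)) = subst (λ y → ForcedMove x (π ⟨$⟩ʳ y)) (sym eq) (forced x)

-- Even order: making the last vertex precede a given vertex.

module Even (k : ℕ) (0<k : 0 < k) where

  n : ℕ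
  n = suc k + suc k

  last : Fin n
  last = fromℕ< {suc k + k} (+-monoʳ-< (suc k) ≤-refl)

  toℕ-last : toℕ last ≡ suc k + k
  toℕ-last = toℕ-fromℕ< (+-monoʳ-< (suc k) ≤-refl)

  small : ∀ {j} → j < suc k → j < n
  small j<m = ≤-trans j<m (m≤m+n (suc k) (suc k))

  module _ (v : Fin n) (m≤v : suc k ≤ toℕ v) (v≤2k : toℕ v ≤ k + k) where

    -- The bound on `v` is exactly what the last vertex allows: 2 (2 k + 1) - (2 k + 2) = 2 k.
    last-forced : ForcedMove last v
    last-forced = inj₂ (begin
      toℕ v + n               ≤⟨ +-monoˡ-≤ n v≤2k ⟩
      k + k + n               ≡⟨ identity k ⟩
      suc k + k + (suc k + k) ≡⟨ cong₂ _+_ toℕ-last toℕ-last ⟨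
      toℕ last + toℕ last     ∎)
      where
      open ≤-Reasoning
      identity : ∀ k → k + k + (suc k + suc k) ≡ suc k + k + (suc k + k)
      identity = solve-∀

    last≢0 : toℕ last ≢ 0
    last≢0 eq with () ← trans (sym toℕ-last) eq

    last≢m : toℕ last ≢ suc k
    last≢m eq = n>0⇒n≢0 0<k (+-cancelˡ-≡ (suc k) k 0 (trans (sym toℕ-last) (trans eq (sym (+-identityʳ _)))))

    -- Exchanging the images of `p` and `last` sends `last` to `v`. In return `p` is sent to 2 k,
    -- which is forced since 2 p < v and v ≤ 2 k.
    redirect : ∀ {π p} → Valid (suc k) π → toℕ (π ⟨$⟩ʳ last) ≡ k + k → π ⟨$⟩ʳ p ≡ v →
               toℕ p + toℕ p < toℕ v → toℕ p ≢ 0 →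
               ∃[ σ ] (Valid (suc k) σ × σ ⟨$⟩ʳ last ≡ v)
    redirect {π} {p} π-valid πlast πp 2p<v p≢0 =
      transpose p last ∘ₚ π ,
      transpose-valid π-valid (inj₁ (≤-trans 2p<v (≤-trans v≤2k (≤-reflexive (sym πlast)))))
        (subst (ForcedMove last) (sym πp) last-forced) p≢0 last≢0 (<⇒≢ p<m) last≢m ,
      trans (cong (π ⟨$⟩ʳ_) (transposeʳ p last)) πp
      where
      p<m : toℕ p < suc k
      p<m = ≰⇒> λ m≤p → <⇒≱ 2p<v (≤-trans v≤2k (≤-trans (+-mono-≤ (n≤1+n k) (n≤1+n k)) (+-mono-≤ m≤p m≤p)))

    -- If v is even, its predecessor under the shuffle is not left of the centre; a first
    -- transposition with the predecessor of v - 1 moves it there.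
    successor : ∃[ σ ] (Valid (suc k) σ × σ ⟨$⟩ʳ last ≡ v)
    successor with halve (toℕ v)
    -- The predecessor of v = 2 j + 1 is j, already left of the centre; it is not 0 because v ≥ k +
    -- 1 ≥ 2.
    ... | j , inj₂ v≡2j+1 = redirect (shuffle-valid k) (shuffleʳ (suc k) toℕ-last)
            (toℕ-injective (trans (shuffleˡ (suc k) (subst (_< suc k) (sym p≡j) j<m))
              (trans (cong (λ i → suc (i + i)) p≡j) (sym v≡2j+1))))
            (≤-reflexive (trans (cong (λ i → suc (i + i)) p≡j) (sym v≡2j+1)))
            λ p≡0 → j≢0 (trans (sym p≡j) p≡0)
      where
      j<m : j < suc k
      j<m = ≰⇒> λ m≤j → <⇒≱ (≤-trans (s≤s (+-mono-≤ m≤j m≤j)) (≤-reflexive (sym v≡2j+1)))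
                              (≤-trans v≤2k (+-mono-≤ (n≤1+n k) (n≤1+n k)))
      p≡j : toℕ (fromℕ< (small j<m)) ≡ j
      p≡j = toℕ-fromℕ< (small j<m)
      j≢0 : j ≢ 0
      j≢0 refl = <⇒≱ (s≤s 0<k) (≤-trans m≤v (≤-reflexive v≡2j+1))
    ... | zero , inj₁ v≡0 = contradiction (subst (suc k ≤_) v≡0 m≤v) λ ()
    ... | suc i , inj₁ v≡2j with m≤n⇒m<n∨m≡n (≤-trans (≤-reflexive (sym v≡2j)) v≤2k)
    -- The unmodified shuffle sends the last vertex to 2 k.
    ...   | inj₂ 2j≡2k = shuffle (suc k) , shuffle-valid k ,
              toℕ-injective (trans (shuffleʳ (suc k) toℕ-last) (sym (trans v≡2j 2j≡2k)))
    ...   | inj₁ 2j<2k =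
              redirect (transpose-valid (shuffle-valid k) pq qp p≢0 q≢0 p≢m (<⇒≢ q<m))
                (trans (cong (λ x → toℕ (shuffle (suc k) ⟨$⟩ʳ x)) (transpose-≢ last≢p last≢q))
                       (shuffleʳ (suc k) toℕ-last))
                (trans (cong (shuffle (suc k) ⟨$⟩ʳ_) (transposeʳ p q)) (toℕ-injective (trans πp (sym v≡2j))))
                2q<v q≢0
      where
      j<k : suc i < k
      j<k = ≰⇒> λ k≤j → <⇒≱ 2j<2k (+-mono-≤ k≤j k≤j)
      -- With j = i + 1, `p` is k + 1 + j, the predecessor of v = 2 j, and `q` is j - 1, the
      -- predecessor of v - 1. After the exchange `q` precedes v, and 2 q = v - 2.
      p q : Fin n
      p = fromℕ< {suc k + suc i} (+-monoʳ-< (suc k) (m<n⇒m<1+n j<k))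
      q = fromℕ< (small (<-trans ≤-refl (m<n⇒m<1+n j<k)))
      p≡ : toℕ p ≡ suc k + suc i
      p≡ = toℕ-fromℕ< (+-monoʳ-< (suc k) (m<n⇒m<1+n j<k))
      q≡ : toℕ q ≡ i
      q≡ = toℕ-fromℕ< (small (<-trans ≤-refl (m<n⇒m<1+n j<k)))
      q<m : toℕ q < suc k
      q<m = subst (_< suc k) (sym q≡) (<-trans ≤-refl (m<n⇒m<1+n j<k))
      πp : toℕ (shuffle (suc k) ⟨$⟩ʳ p) ≡ suc i + suc i
      πp = shuffleʳ (suc k) p≡
      πq : toℕ (shuffle (suc k) ⟨$⟩ʳ q) ≡ suc (i + i)
      πq = trans (shuffleˡ (suc k) q<m) (cong (λ i → suc (i + i)) q≡)
      2q<v : toℕ q + toℕ q < toℕ v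
      2q<v = subst₂ _<_ (sym (cong₂ _+_ q≡ q≡)) (sym v≡2j) (+-mono-< ≤-refl ≤-refl)
      pq : ForcedMove p (shuffle (suc k) ⟨$⟩ʳ q)
      pq = inj₂ (begin
        toℕ (shuffle (suc k) ⟨$⟩ʳ q) + n      ≡⟨ cong (_+ n) πq ⟩
        suc (i + i) + n                       ≤⟨ n≤1+n _ ⟩
        suc (suc (i + i) + n)                 ≡⟨ identity i k ⟩
        suc k + suc i + (suc k + suc i)       ≡⟨ cong₂ _+_ p≡ p≡ ⟨
        toℕ p + toℕ p                         ∎)
        where
        open ≤-Reasoning
        identity : ∀ i k → suc (suc (i + i) + (suc k + suc k)) ≡ suc k + suc i + (suc k + suc i)
        identity = solve-∀
      qp : ForcedMove q (shuffle (suc k) ⟨$⟩ʳ p)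
      qp = inj₁ (subst (toℕ q + toℕ q <_) (trans v≡2j (sym πp)) 2q<v)
      p≢0 : toℕ p ≢ 0
      p≢0 eq with () ← trans (sym p≡) eq
      p≢m : toℕ p ≢ suc k
      p≢m eq with () ← +-cancelˡ-≡ (suc k) (suc i) 0 (trans (sym p≡) (trans eq (sym (+-identityʳ _))))
      q≢0 : toℕ q ≢ 0
      -- If i = 0, then v = 2, and k + 1 ≤ v contradicts 1 < k.
      q≢0 eq with refl ← trans (sym q≡) eq = <⇒≱ j<k (s≤s⁻¹ (≤-trans m≤v (≤-reflexive v≡2j)))
      last≢p : last ≢ p
      last≢p eq = <⇒≢ j<k (+-cancelˡ-≡ (suc k) (suc i) k (trans (sym p≡) (trans (cong toℕ (sym eq)) toℕ-last)))
      last≢q : last ≢ q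
      last≢q eq = <⇒≱ q<m (≤-trans (m≤m+n (suc k) k) (≤-reflexive (trans (sym toℕ-last) (cong toℕ eq))))

-- Even order: merging the orbits into one cycle.

module Merge (k : ℕ) (v : Fin (suc (suc k) + suc (suc k)))
             (m≤v : suc (suc k) ≤ toℕ v) (v≤2k : toℕ v ≤ suc k + suc k)
             (σ : Permutation′ (suc (suc k) + suc (suc k))) (σ-valid : Valid (suc (suc k)) σ)
             (σ-last : σ ⟨$⟩ʳ Even.last (suc k) z<s ≡ v) where

  open Even (suc k) z<s using (n; last; toℕ-last)
  open Valid σ-valid

  m : ℕ
  m = suc (suc k)

  -- Recording that v is preceded only by last lets the edge last → v survive the merging.
  R : Fin n → Fin n → Set
  R x w = ForcedMove x w × (w ≡ v → x ≡ last)

  R-σ : ∀ x → R x (σ ⟨$⟩ʳ x)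
  R-σ x = forced x , λ σx≡v →
    trans (sym (inverseˡ σ)) (trans (cong (σ ⟨$⟩ˡ_) (trans σx≡v (sym σ-last))) (inverseˡ σ))

  open Orbits σ R R-σ

  σ≢v : ∀ {x} → toℕ x < suc m + k → σ ⟨$⟩ʳ x ≢ v
  σ≢v {x} x<last σx≡v = <⇒≢ x<last
    (trans (cong toℕ (π-injective (trans σx≡v (sym σ-last)))) (trans toℕ-last (+-suc m k)))

  origin centre : Fin n
  origin = Fin.zero
  centre = fromℕ< (m<m+n m z<s)

  toℕ-centre : toℕ centre ≡ m
  toℕ-centre = toℕ-fromℕ< (m<m+n m z<s)

  double-≤ : ∀ i → i + i ≤ suc i + suc i
  double-≤ i = +-mono-≤ (n≤1+n i) (n≤1+n i)

  -- The bound on `h` is 2 z - n for the next vertex z = m + i + 1, so that z → h is forced. `0<h`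
  -- makes the closing edge 0 → h forced, and `h≢v` lets z → h satisfy `R`.
  record Stage (i : ℕ) : Set where
    field
      {h}      : Fin n
      {K}      : List (Fin n)
      path     : Path R h origin K
      unique   : Unique K
      closed   : Closed K
      0<h      : 0 < toℕ h
      h≤       : toℕ h ≤ suc i + suc i
      h≢v      : h ≢ v
      includes : ∀ {x} → m ≤ toℕ x → toℕ x ≤ m + i → x ∈ K

  stage : ∀ i → i ≤ k → Stage i
  stage zero _ with orbit {[]} ((λ ()) , (λ ())) origin (λ ())
  ... | b , p , b! , _ , b-closed = record
    { path     = p
    ; unique   = b!
    ; closed   = b-closed
    ; 0<h      = ≤-reflexive (sym (hub origin refl))
    ; h≤       = ≤-trans (≤-reflexive (hub origin refl)) (n≤1+n 1)
    ; h≢v      = σ≢v z<s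
    -- At stage 0 only m has to be covered; it is in the orbit of 0 because its image is 0.
    ; includes = λ {x} m≤x x≤m → proj₂ b-closed (subst (_∈ b)
        (sym (toℕ-injective (middle x (≤-antisym (subst (toℕ x ≤_) (+-identityʳ m) x≤m) m≤x)))) (end∈ p))
    }
  stage (suc i) i<k with stage i (<⇒≤ i<k)
  ... | s with _∈?_ _≟_ (fromℕ< (+-monoʳ-< m (m<n⇒m<1+n (s≤s i<k)))) (Stage.K s)
  ...   | yes z∈K = record
    { path = path ; unique = unique ; closed = closed ; 0<h = 0<h
    ; h≤ = ≤-trans h≤ (double-≤ (suc i)) ; h≢v = h≢v
    ; includes = λ m≤x x≤ → extend m≤x (m≤n⇒m<n∨m≡n x≤) }
    where
    open Stage s
    extend : ∀ {x} → m ≤ toℕ x → toℕ x < m + suc i ⊎ toℕ x ≡ m + suc i → x ∈ K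
    extend m≤x (inj₁ x<) = includes m≤x (s≤s⁻¹ (≤-trans x< (≤-reflexive (+-suc m i))))
    extend m≤x (inj₂ x≡) = subst (_∈ K)
      (toℕ-injective (trans (toℕ-fromℕ< (+-monoʳ-< m (m<n⇒m<1+n (s≤s i<k)))) (sym x≡))) z∈K
  ...   | no z∉K = let (K′ , path′ , unique′ , closed′ , z∈K′ , K⊆K′) = absorb path unique closed z∉K zh in record
    { path = path′ ; unique = unique′ ; closed = closed′
    -- The new head is the image of `z`; it is not 0, because m is the only vertex sent to 0.
    ; 0<h = n≢0⇒n>0 λ σz≡0 → z≢m (π-injective (toℕ-injective (trans σz≡0 (sym (middle centre toℕ-centre)))))
    ; h≤ = ≤-trans (σz≤ (forced z)) (double-≤ (suc i))
    ; h≢v = σ≢v (subst (_< suc m + k) (sym z≡) (s≤s (+-monoʳ-≤ m i<k)))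
    ; includes = λ m≤x x≤ → extend z∈K′ K⊆K′ m≤x (m≤n⇒m<n∨m≡n x≤) }
    where
    open Stage s
    z : Fin n
    z = fromℕ< (+-monoʳ-< m (m<n⇒m<1+n (s≤s i<k)))
    z≡ : toℕ z ≡ m + suc i
    z≡ = toℕ-fromℕ< (+-monoʳ-< m (m<n⇒m<1+n (s≤s i<k)))
    2z≡ : toℕ z + toℕ z ≡ suc i + suc i + n
    2z≡ = trans (cong₂ _+_ z≡ z≡) (identity m i)
      where
      identity : ∀ m i → m + suc i + (m + suc i) ≡ suc i + suc i + (m + m)
      identity = solve-∀
    z≢m : z ≢ centre
    z≢m z≡c with () ← +-cancelˡ-≡ m (suc i) 0
                        (trans (sym z≡) (trans (cong toℕ z≡c) (trans toℕ-centre (sym (+-identityʳ m)))))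
    -- Since 2 z ≥ n, no vertex lies far enough right for a forced move, so `z` moves left.
    σz≤ : ForcedMove z (σ ⟨$⟩ʳ z) → toℕ (σ ⟨$⟩ʳ z) ≤ suc i + suc i
    σz≤ (inj₁ 2z<) = contradiction (toℕ<n (σ ⟨$⟩ʳ z))
      (<⇒≯ (≤-<-trans (≤-trans (m≤n+m n (suc i + suc i)) (≤-reflexive (sym 2z≡))) 2z<))
    σz≤ (inj₂ ≤2z) = +-cancelʳ-≤ n _ _ (≤-trans ≤2z (≤-reflexive 2z≡))
    zh : R z h
    zh = inj₂ (≤-trans (+-monoˡ-≤ n h≤) (≤-reflexive (sym 2z≡))) , λ h≡v → contradiction h≡v h≢v
    extend : ∀ {K′ x} → z ∈ K′ → (∀ {y} → y ∈ K → y ∈ K′) →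
             m ≤ toℕ x → toℕ x < m + suc i ⊎ toℕ x ≡ m + suc i → x ∈ K′
    extend _ K⊆K′ m≤x (inj₁ x<) = K⊆K′ (includes m≤x (s≤s⁻¹ (≤-trans x< (≤-reflexive (+-suc m i)))))
    extend {K′} z∈K′ _ m≤x (inj₂ x≡) = subst (_∈ K′) (toℕ-injective (trans z≡ (sym x≡))) z∈K′

  open Stage (stage k ≤-refl)

  -- The stages stop at 2 m - 2. They cover `v`, and backward closure then supplies its preimage
  -- `last`.
  last∈ : last ∈ K
  last∈ = proj₂ closed (subst (_∈ K) (sym σ-last) (includes m≤v (≤-trans v≤2k (≤-reflexive (+-suc (suc k) k)))))

  right∈ : ∀ {x} → m ≤ toℕ x → x ∈ K
  right∈ {x} m≤x with m≤n⇒m<n∨m≡n (s≤s⁻¹ (toℕ<n x))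
  ... | inj₁ x<last = includes m≤x (s≤s⁻¹ (≤-trans x<last
                        (≤-reflexive (trans (+-suc (suc k) (suc k)) (cong suc (+-suc (suc k) k))))))
  ... | inj₂ x≡last = subst (_∈ K)
                        (toℕ-injective (trans toℕ-last (trans (sym (+-suc (suc k) (suc k))) (sym x≡last)))) last∈

  -- Left of the centre forced moves go right, so iterating `σ` reaches a vertex of the right half;
  -- backward closure returns from there to `x`. The fuel is at least n - x.
  all∈ : ∀ f x → n ≤ toℕ x + f → x ∈ K
  all∈ zero    x n≤ = contradiction (toℕ<n x) (≤⇒≯ (subst (n ≤_) (+-identityʳ _) n≤))
  all∈ (suc f) x n≤ with m ≤? toℕ x | forced x
  ... | yes m≤x | _ = right∈ m≤x
  ... | no  _   | inj₁ 2x<σx = proj₂ closed (all∈ f (σ ⟨$⟩ʳ x) (≤-trans n≤ (≤-trans (≤-reflexive (+-suc _ f))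
                                 (+-monoˡ-≤ f (≤-trans (s≤s (m≤m+n _ _)) 2x<σx)))))
  ... | no  m≰x | inj₂ ≤2x = contradiction (≤-trans (m≤n+m n _) ≤2x) (<⇒≱ (+-mono-< (≰⇒> m≰x) (≰⇒> m≰x)))

  ham : Hamiltonian v last
  ham with split path (all∈ n v (m≤n+m n _))
  ... | inj₁ h≡v = contradiction h≡v h≢v
  -- By `R` the edge entering `v` comes from `last`. Dropping it and closing up by 0 → h gives a
  -- path from `v` to `last`.
  ... | inj₂ (y , b , b′ , p , (_ , y≡last) , q , K≡) with refl ← y≡last refl =
    b′ ++ b , join (weaken proj₁ q) (inj₁ 0<h) (weaken proj₁ p) ,
    unique-++-comm b (subst Unique K≡ unique) ,
    λ x → rotate-all b (subst (x ∈_) K≡ (all∈ n x (m≤n+m n _)))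

ham-to-last : ∀ k (v : Fin (suc (suc k) + suc (suc k))) →
              suc (suc k) ≤ toℕ v → toℕ v ≤ suc k + suc k → Hamiltonian v (Even.last (suc k) z<s)
ham-to-last k v m≤v v≤2k with Even.successor (suc k) z<s v m≤v v≤2k
... | σ , σ-valid , σ-last = Merge.ham k v m≤v v≤2k σ σ-valid σ-last

-- Strategies from Hamiltonian paths, and mirror images.

Winning : ∀ n → Fin n → List ℕ → Set
Winning n v S =
  AlwaysLegal (pathGraph n) v S ×
  (∀ ps → Play (pathGraph n) v S ps → VisitsEachOnce (pathGraph n) ps)

ham⇒winning : ∀ {n} {v z : Fin n} → Hamiltonian v z → ∃[ S ] Winning n v S
ham⇒winning (l , p , l! , all) =
  calls l , alwaysLegal p ,
  λ ps play → subst (VisitsEachOnce (pathGraph _)) (sym (play-unique p play)) (visitsEachOnce l! all)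

opposite-sum : ∀ {n} (u : Fin n) → toℕ (opposite u) + suc (toℕ u) ≡ n
opposite-sum u = trans (cong (_+ suc (toℕ u)) (opposite-prop u)) (m∸n+n≡m (toℕ<n u))

opposite-injective : ∀ {n} {u w : Fin n} → opposite u ≡ opposite w → u ≡ w
opposite-injective {u = u} {w} eq =
  trans (sym (opposite-involutive u)) (trans (cong opposite eq) (opposite-involutive w))

-- Mirroring exchanges the ends, so overshooting on the left becomes overshooting on the right and
-- the two cases of `Forced` are swapped.
opposite-forced : ∀ {n} {u w : Fin n} → ForcedMove u w → ForcedMove (opposite u) (opposite w)
opposite-forced {n} {u} {w} = λ
  -- The summand cancelled here replaces subtraction: the mirrored positions enter only through x′ +
  -- suc x = n and y′ + suc y = n.
  { (inj₁ 2u<w) → inj₂ (+-cancelʳ-≤ (x + suc x + suc y) _ _ (begin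
      y′ + n + (x + suc x + suc y)     ≡⟨ left n x y y′ ⟩
      (y′ + suc y) + n + suc (x + x)   ≡⟨ cong (λ c → c + n + suc (x + x)) (opposite-sum w) ⟩
      n + n + suc (x + x)              ≤⟨ +-monoʳ-≤ (n + n) 2u<w ⟩
      n + n + y                        ≡⟨ cong (λ c → c + c + y) (opposite-sum u) ⟨
      (x′ + suc x) + (x′ + suc x) + y  ≡⟨ right x x′ y ⟩
      x′ + x′ + (x + suc x + suc y)    ∎))
  ; (inj₂ w+n≤2u) → inj₁ (+-cancelʳ-≤ (x + suc x + y) _ _ (begin
      suc (x′ + x′) + (x + suc x + y)  ≡⟨ right′ x x′ y ⟩
      (x′ + suc x) + ((x′ + suc x) + y) ≡⟨ cong (λ c → c + (c + y)) (opposite-sum u) ⟩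
      n + (n + y)                      ≡⟨ cong (n +_) (+-comm n y) ⟩
      n + (y + n)                      ≤⟨ +-monoʳ-≤ n w+n≤2u ⟩
      n + (x + x)                      ≡⟨ cong (_+ (x + x)) (opposite-sum w) ⟨
      y′ + suc y + (x + x)             ≡⟨ left′ x y y′ ⟩
      y′ + (x + suc x + y)             ∎)) }
  where
  open ≤-Reasoning
  x x′ y y′ : ℕ
  x  = toℕ u
  x′ = toℕ (opposite u)
  y  = toℕ w
  y′ = toℕ (opposite w)
  left : ∀ n x y y′ → y′ + n + (x + suc x + suc y) ≡ (y′ + suc y) + n + suc (x + x)
  left = solve-∀
  right : ∀ x x′ y → (x′ + suc x) + (x′ + suc x) + y ≡ x′ + x′ + (x + suc x + suc y)
  right = solve-∀
  right′ : ∀ x x′ y → suc (x′ + x′) + (x + suc x + y) ≡ (x′ + suc x) + ((x′ + suc x) + y)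
  right′ = solve-∀
  left′ : ∀ x y y′ → y′ + suc y + (x + x) ≡ y′ + (x + suc x + y)
  left′ = solve-∀

opposite-dist : ∀ {n} (u w : Fin n) → dist (opposite u) (opposite w) ≡ dist u w
opposite-dist {n} u w = begin
  ∣ x′ - y′ ∣                                     ≡⟨ ∣m+n-m+o∣≡∣n-o∣ (suc x + suc y) x′ y′ ⟨
  ∣ suc x + suc y + x′ - suc x + suc y + y′ ∣     ≡⟨ cong₂ ∣_-_∣ (left x x′ y) (right x y y′) ⟩
  ∣ x′ + suc x + suc y - y′ + suc y + suc x ∣     ≡⟨ cong₂ (λ a b → ∣ a + suc y - b + suc x ∣)
                                                             (opposite-sum u) (opposite-sum w) ⟩
  ∣ n + suc y - n + suc x ∣                       ≡⟨ ∣m+n-m+o∣≡∣n-o∣ n (suc y) (suc x) ⟩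
  ∣ y - x ∣                                       ≡⟨ ∣-∣-comm y x ⟩
  ∣ x - y ∣                                       ∎
  where
  open ≡-Reasoning
  x x′ y y′ : ℕ
  x  = toℕ u
  x′ = toℕ (opposite u)
  y  = toℕ w
  y′ = toℕ (opposite w)
  left : ∀ x x′ y → suc x + suc y + x′ ≡ x′ + suc x + suc y
  left = solve-∀
  right : ∀ x y y′ → suc x + suc y + y′ ≡ y′ + suc y + suc x
  right = solve-∀

-- Thus one sequence of calls serves a path and its mirror image, as is required when the first call
-- may lead to either end.
opposite-calls : ∀ {n} (l : List (Fin n)) → calls (map opposite l) ≡ calls l
opposite-calls []          = refl
opposite-calls (_ ∷ [])    = refl
opposite-calls (x ∷ y ∷ l) = cong₂ _∷_ (opposite-dist x y) (opposite-calls (y ∷ l))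

opposite-∈ : ∀ {n} {x : Fin n} {l} → opposite x ∈ l → x ∈ map opposite l
opposite-∈ {x = x} x∈ = subst (_∈ _) (opposite-involutive x) (∈-map⁺ opposite x∈)

opposite-ham : ∀ {n} {v z : Fin n} → Hamiltonian v z → Hamiltonian (opposite v) (opposite z)
opposite-ham (l , p , l! , all) =
  map opposite l , map-path opposite opposite-forced p , Unique.map⁺ opposite-injective l! ,
  λ x → opposite-∈ (all (opposite x))

-- Paths of even order.

-- With the closing move from `z` to `u` the path is a cycle, which can be opened at any vertex.
rotate : ∀ {n} {u z : Fin n} → Hamiltonian u z → ForcedMove z u → ∀ v → ∃[ y ] Hamiltonian v y
rotate h@(l , p , l! , all) zu v with split p (all v)
... | inj₁ refl = _ , h
... | inj₂ (y , k , k′ , q , _ , q′ , refl) =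
  y , k′ ++ k , join q′ zu q , unique-++-comm k l! , λ x → rotate-all k (all x)

even : ∀ m (v : Fin (m + m)) → ∃[ z ] Hamiltonian v z
even (suc zero) = rotate ham₂ (inj₂ ≤-refl)
  where
  ham₂ : Hamiltonian {2} 0F 1F
  ham₂ = _ , inj₁ z<s ∷ [ 1F ] , ((λ ()) All.∷ All.[]) ∷ (All.[] ∷ []) ,
         λ { 0F → here refl ; 1F → there (here refl) }
-- The path from 2 m - 2 to 2 m - 1 is closed into a cycle by the forced move back.
even (suc (suc k)) = rotate (ham-to-last k u m≤u u≤2k) (Even.last-forced (suc k) z<s u m≤u u≤2k)
  where
  bound : suc k + suc k < suc (suc k) + suc (suc k)
  bound = +-mono-< (n<1+n (suc k)) (n<1+n (suc k))
  u : Fin (suc (suc k) + suc (suc k))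
  u = fromℕ< bound
  m≤u : suc (suc k) ≤ toℕ u
  m≤u = ≤-trans (s≤s (m≤n+m (suc k) k)) (≤-reflexive (sym (toℕ-fromℕ< bound)))
  u≤2k : toℕ u ≤ suc k + suc k
  u≤2k = ≤-reflexive (toℕ-fromℕ< bound)

-- Odd order: inserting a centre.

toℕ-punchIn-< : ∀ {n} (i : Fin (suc n)) (j : Fin n) → toℕ j < toℕ i → toℕ (punchIn i j) ≡ toℕ j
toℕ-punchIn-< (Fin.suc i) Fin.zero    _   = refl
toℕ-punchIn-< (Fin.suc i) (Fin.suc j) j<i = cong suc (toℕ-punchIn-< i j (s<s⁻¹ j<i))

toℕ-punchIn-≥ : ∀ {n} (i : Fin (suc n)) (j : Fin n) → toℕ i ≤ toℕ j → toℕ (punchIn i j) ≡ suc (toℕ j)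
toℕ-punchIn-≥ Fin.zero    j           _   = refl
toℕ-punchIn-≥ (Fin.suc i) (Fin.suc j) i≤j = cong suc (toℕ-punchIn-≥ i j (s≤s⁻¹ i≤j))

toℕ-punchIn : ∀ {n} (i : Fin (suc n)) (j : Fin n) →
              toℕ j ≤ toℕ (punchIn i j) × toℕ (punchIn i j) ≤ suc (toℕ j)
toℕ-punchIn i j with toℕ j <? toℕ i
... | yes j<i rewrite toℕ-punchIn-< i j j<i = ≤-refl , n≤1+n _
... | no  j≮i rewrite toℕ-punchIn-≥ i j (≮⇒≥ j≮i) = n≤1+n _ , ≤-refl

module Odd (m : ℕ) (0<m : 0 < m) where

  n : ℕ
  n = suc (m + m)

  centre end : Fin n
  centre = fromℕ< {m} (s≤s (m≤m+n m m))
  end    = Fin.fromℕ (m + m)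

  toℕ-centre : toℕ centre ≡ m
  toℕ-centre = toℕ-fromℕ< (s≤s (m≤m+n m m))

  toℕ-end : toℕ end ≡ m + m
  toℕ-end = toℕ-fromℕ (m + m)

  -- The centre is left out so that it can be either appended at the end or used as the start.
  Avoiding : Fin n → List (Fin n) → Set
  Avoiding v l = Path ForcedMove v end l × Unique l × centre ∉ l × (∀ {x} → x ≢ centre → x ∈ l)

  end-centre : ForcedMove end centre
  end-centre = inj₂ (begin
    toℕ centre + n     ≡⟨ cong (_+ n) toℕ-centre ⟩
    m + suc (m + m)    ≡⟨ +-suc m (m + m) ⟩
    suc m + (m + m)    ≤⟨ +-monoˡ-≤ (m + m) (m<m+n m 0<m) ⟩
    m + m + (m + m)    ≡⟨ cong₂ _+_ toℕ-end toℕ-end ⟨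
    toℕ end + toℕ end  ∎)
    where open ≤-Reasoning

  finish : ∀ {v l} → Avoiding v l → Hamiltonian v centre
  finish {l = l} (p , l! , c∉l , all) =
    l ++ centre ∷ [] , join p end-centre [ centre ] ,
    Unique.++⁺ l! (All.[] ∷ []) (λ { (c∈l , here refl) → c∉l c∈l }) , all′
    where
    all′ : ∀ x → x ∈ l ++ centre ∷ []
    all′ x with x ≟ centre
    ... | yes x≡c = ∈-++⁺ʳ l (here x≡c)
    ... | no  x≢c = ∈-++⁺ˡ (all x≢c)

  -- A forced move to the right starts left of the centre, so its start stays and its target can
  -- only grow. For one to the left, 2 u grows by 2, the order by 1 and the target by at most 1.
  punchIn-forced : ∀ {u w} → ForcedMove u w → ForcedMove (punchIn centre u) (punchIn centre w)
  punchIn-forced {u} {w} (inj₁ 2u<w) = inj₁ (subst (λ x → x + x < toℕ (punchIn centre w))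
    (sym (toℕ-punchIn-< centre u u<c)) (≤-trans 2u<w (proj₁ (toℕ-punchIn centre w))))
    where
    u<c : toℕ u < toℕ centre
    u<c = subst (toℕ u <_) (sym toℕ-centre)
            (≰⇒> λ m≤u → <⇒≱ (<-trans 2u<w (toℕ<n w)) (+-mono-≤ m≤u m≤u))
  punchIn-forced {u} {w} (inj₂ w+2m≤2u) = inj₂ (subst (λ x → toℕ (punchIn centre w) + n ≤ x + x)
    (sym (toℕ-punchIn-≥ centre u c≤u)) (begin
      toℕ (punchIn centre w) + n     ≤⟨ +-monoˡ-≤ n (proj₂ (toℕ-punchIn centre w)) ⟩
      suc (toℕ w) + suc (m + m)      ≡⟨ cong suc (+-suc (toℕ w) (m + m)) ⟩
      suc (suc (toℕ w + (m + m)))    ≤⟨ s≤s (s≤s w+2m≤2u) ⟩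
      suc (suc (toℕ u + toℕ u))      ≡⟨ cong suc (+-suc (toℕ u) (toℕ u)) ⟨
      suc (toℕ u) + suc (toℕ u)      ∎))
    where
    open ≤-Reasoning
    c≤u : toℕ centre ≤ toℕ u
    c≤u = subst (_≤ toℕ u) (sym toℕ-centre)
            (≮⇒≥ λ u<m → <⇒≱ (+-mono-< u<m u<m) (≤-trans (m≤n+m (m + m) (toℕ w)) w+2m≤2u))

  punchIn-avoiding : ∀ {v z} → Hamiltonian v z → punchIn centre z ≡ end → ∃[ l ] Avoiding (punchIn centre v) l
  punchIn-avoiding (l , p , l! , all) z≡end =
    map (punchIn centre) l ,
    subst (λ z → Path ForcedMove _ z _) z≡end (map-path (punchIn centre) punchIn-forced p) ,
    Unique.map⁺ (punchIn-injective centre _ _) l! ,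
    (λ c∈ → let (y , _ , c≡) = ∈-map⁻ (punchIn centre) c∈ in punchInᵢ≢i centre y (sym c≡)) ,
    λ x≢c → subst (_∈ _) (punchIn-punchOut (x≢c ∘ sym)) (∈-map⁺ (punchIn centre) (all (punchOut (x≢c ∘ sym))))

  -- The zigzag around the centre.

  -- The vertices still to be visited when the zigzag 0, m + 1, 1, m + 2, … reaches i.
  Remaining : ℕ → Fin n → Set
  Remaining i x = (i ≤ toℕ x × toℕ x < m) ⊎ suc m + i ≤ toℕ x

  Lists : ℕ → List (Fin n) → Set
  Lists i l = Unique l × (∀ {x} → x ∈ l → Remaining i x) × (∀ {x} → Remaining i x → x ∈ l)

  module _ {i} (i<m : i < m) where

    lo hi : Fin n
    lo = fromℕ< (≤-trans i<m (≤-trans (m≤m+n m m) (n≤1+n _)))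
    hi = fromℕ< (s≤s (+-monoʳ-< m i<m))

    toℕ-lo : toℕ lo ≡ i
    toℕ-lo = toℕ-fromℕ< (≤-trans i<m (≤-trans (m≤m+n m m) (n≤1+n _)))

    toℕ-hi : toℕ hi ≡ suc m + i
    toℕ-hi = toℕ-fromℕ< (s≤s (+-monoʳ-< m i<m))

    lists-∷ : ∀ {l} → Lists (suc i) l → Lists i (lo ∷ hi ∷ l)
    lists-∷ {l} (l! , sound , complete) = ¬Any⇒All¬ _ lo∉ ∷ (¬Any⇒All¬ _ hi∉ ∷ l!) , sound′ , complete′
      where
      hi∉ : hi ∉ l
      hi∉ hi∈ with sound hi∈
      ... | inj₁ (_ , hi<m) = <⇒≱ hi<m (≤-trans (m≤n+m m (suc i))
              (≤-reflexive (trans (+-comm (suc i) m) (trans (+-suc m i) (sym toℕ-hi)))))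
      ... | inj₂ ≤hi = <⇒≱ (+-monoʳ-< (suc m) ≤-refl) (≤-trans ≤hi (≤-reflexive toℕ-hi))
      lo∉ : lo ∉ hi ∷ l
      lo∉ (here lo≡hi) = <⇒≢ (s≤s (m≤n+m i m)) (trans (sym toℕ-lo) (trans (cong toℕ lo≡hi) toℕ-hi))
      lo∉ (there lo∈) with sound lo∈
      ... | inj₁ (i<lo , _) = <⇒≢ i<lo (sym toℕ-lo)
      ... | inj₂ ≤lo = <⇒≱ (s≤s (≤-trans (n≤1+n i) (m≤n+m (suc i) m))) (≤-trans ≤lo (≤-reflexive toℕ-lo))
      sound′ : ∀ {x} → x ∈ lo ∷ hi ∷ l → Remaining i x
      sound′ (here refl) = inj₁ (≤-reflexive (sym toℕ-lo) , subst (_< m) (sym toℕ-lo) i<m)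
      sound′ (there (here refl)) = inj₂ (≤-reflexive (sym toℕ-hi))
      sound′ (there (there x∈)) with sound x∈
      ... | inj₁ (i<x , x<m) = inj₁ (<⇒≤ i<x , x<m)
      ... | inj₂ ≤x = inj₂ (≤-trans (+-monoʳ-≤ (suc m) (n≤1+n i)) ≤x)
      complete′ : ∀ {x} → Remaining i x → x ∈ lo ∷ hi ∷ l
      complete′ (inj₁ (i≤x , x<m)) with m≤n⇒m<n∨m≡n i≤x
      ... | inj₁ i<x = there (there (complete (inj₁ (i<x , x<m))))
      ... | inj₂ i≡x = here (toℕ-injective (trans (sym i≡x) (sym toℕ-lo)))
      complete′ (inj₂ ≤x) with m≤n⇒m<n∨m≡n ≤x
      ... | inj₁ <x = there (there (complete (inj₂ (≤-trans (≤-reflexive (+-suc (suc m) i)) <x))))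
      ... | inj₂ ≡x = there (here (toℕ-injective (trans (sym ≡x) (sym toℕ-hi))))

    lo-hi : ForcedMove lo hi
    lo-hi = inj₁ (subst₂ _<_ (sym (cong₂ _+_ toℕ-lo toℕ-lo)) (sym toℕ-hi) (s≤s (+-monoˡ-≤ i (<⇒≤ i<m))))

  hi-lo : ∀ {i} (i<m : i < m) (i+1<m : suc i < m) → ForcedMove (hi i<m) (lo i+1<m)
  hi-lo {i} i<m i+1<m = inj₂ (begin
    toℕ (lo i+1<m) + n               ≡⟨ cong (_+ n) (toℕ-lo i+1<m) ⟩
    -- The move has slack exactly i.
    suc i + suc (m + m)              ≤⟨ m≤m+n _ i ⟩
    suc i + suc (m + m) + i          ≡⟨ identity m i ⟩
    suc m + i + (suc m + i)          ≡⟨ cong₂ _+_ (toℕ-hi i<m) (toℕ-hi i<m) ⟨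
    toℕ (hi i<m) + toℕ (hi i<m)      ∎)
    where
    open ≤-Reasoning
    identity : ∀ m i → suc i + suc (m + m) + i ≡ suc m + i + (suc m + i)
    identity = solve-∀

  -- Here `j` counts the pairs `lo`, `hi` after the current one; in the final pair i = m - 1 and
  -- `hi` is the end vertex 2 m.
  zigzag : ∀ j {i} (i<m : i < m) → i + suc j ≡ m → ∃[ l ] (Path ForcedMove (lo i<m) end l × Lists i l)
  zigzag zero {i} i<m eq =
    lo i<m ∷ hi i<m ∷ [] ,
    subst (λ z → Path ForcedMove (lo i<m) z (lo i<m ∷ hi i<m ∷ [])) hi≡end (lo-hi i<m ∷ [ hi i<m ]) ,
    lists-∷ i<m ([] , (λ ()) , λ
      { (inj₁ (i<x , x<m)) → contradiction x<m (≤⇒≯ (≤-trans (≤-reflexive (sym i+1≡m)) i<x))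
      ; {x} (inj₂ ≤x) → contradiction (toℕ<n x) (≤⇒≯ (≤-trans (≤-reflexive (cong (suc m +_) (sym i+1≡m))) ≤x)) })
    where
    i+1≡m : suc i ≡ m
    i+1≡m = trans (+-comm 1 i) eq
    hi≡end : hi i<m ≡ end
    hi≡end = toℕ-injective (trans (toℕ-hi i<m)
      (trans (sym (+-suc m i)) (trans (cong (m +_) i+1≡m) (sym toℕ-end))))
  zigzag (suc j) {i} i<m eq =
    let (l , p , lists) = zigzag j i+1<m (trans (sym (+-suc i (suc j))) eq)
    in lo i<m ∷ hi i<m ∷ l , lo-hi i<m ∷ (hi-lo i<m i+1<m ∷ p) , lists-∷ i<m lists
    where
    i+1<m : suc i < m
    i+1<m = subst (suc i <_) eq (≤-trans (≤-reflexive (+-comm 2 i)) (+-monoʳ-≤ i (s≤s (s≤s z≤n))))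

  from-zero : ∃[ l ] Avoiding Fin.zero l
  from-zero with zigzag (pred m) 0<m (suc-pred m {{>-nonZero 0<m}})
  ... | l , p , l! , sound , complete =
    l , subst (λ v → Path ForcedMove v end l) (toℕ-injective (toℕ-lo 0<m)) p , l! ,
    (λ c∈ → centre-visited (sound c∈)) , λ x≢c → complete (remaining x≢c)
    where
    centre-visited : Remaining 0 centre → ⊥
    centre-visited (inj₁ (_ , c<m)) = <⇒≢ c<m toℕ-centre
    centre-visited (inj₂ m<c) = <⇒≢ (≤-trans (s≤s (m≤m+n m 0)) m<c) (sym toℕ-centre)
    remaining : ∀ {x} → x ≢ centre → Remaining 0 x
    remaining {x} x≢c with <-cmp (toℕ x) m
    ... | tri< x<m _ _ = inj₁ (z≤n , x<m)
    ... | tri≈ _ x≡m _ = contradiction (toℕ-injective (trans x≡m (sym toℕ-centre))) x≢c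
    ... | tri> _ _ m<x = inj₂ (≤-trans (≤-reflexive (+-identityʳ (suc m))) m<x)

  -- Odd order: starting at the centre.

  opposite-sum-2m : ∀ x → toℕ (opposite x) + toℕ x ≡ m + m
  opposite-sum-2m x = suc-injective (trans (sym (+-suc _ _)) (opposite-sum x))

  opposite-centre : ∀ {x} → opposite x ≡ centre → x ≡ centre
  opposite-centre {x} eq = toℕ-injective (trans
    (+-cancelˡ-≡ m (toℕ x) m (trans (cong (_+ toℕ x) (sym (trans (cong toℕ eq) toℕ-centre))) (opposite-sum-2m x)))
    (sym toℕ-centre))

  -- The first call is not forced: both ends are at distance m. The remaining calls drive the token
  -- along `l` or along its mirror image, and both omit exactly the centre, already visited.
  centre-start : ∃[ S ] Winning n centre S
  centre-start with from-zero
  ... | l , p , l! , c∉l , all = m ∷ calls l , legal , wins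
    where
    l′ : List (Fin n)
    l′ = map opposite l
    p′ : Path ForcedMove (opposite Fin.zero) (opposite end) l′
    p′ = map-path opposite (λ {x} {y} → opposite-forced {u = x} {y}) p
    reply : ∀ {w} → Distance (pathGraph n) centre w m → w ≡ Fin.zero ⊎ w ≡ opposite Fin.zero
    reply {w} D with ≤-total (toℕ w) m
    ... | inj₁ w≤m = inj₁ (toℕ-injective (∸-cancelˡ-≡ w≤m z≤n
          (trans (sym (m≤n⇒∣n-m∣≡n∸m w≤m)) (sym (trans (distance⇒≡ D) (cong (∣_- toℕ w ∣) toℕ-centre))))))
    ... | inj₂ m≤w = inj₂ (toℕ-injective
          (trans w≡2m (sym (trans (sym (+-identityʳ _)) (opposite-sum-2m Fin.zero)))))
      where
      w≡2m : toℕ w ≡ m + m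
      w≡2m = trans (sym (m+[n∸m]≡n m≤w)) (cong (m +_) (trans (sym (m≤n⇒∣m-n∣≡n∸m m≤w))
               (sym (trans (distance⇒≡ D) (cong (∣_- toℕ w ∣) toℕ-centre)))))
    legal : AlwaysLegal (pathGraph n) centre (m ∷ calls l)
    legal = call (Fin.zero , subst (Distance (pathGraph n) centre Fin.zero)
                    (trans (∣-∣-identityʳ (toℕ centre)) toℕ-centre) (distance centre Fin.zero)) after
      where
      after : ∀ w → Distance (pathGraph n) centre w m → AlwaysLegal (pathGraph n) w (calls l)
      after w D with reply D
      ... | inj₁ refl = alwaysLegal p
      ... | inj₂ refl = subst (AlwaysLegal (pathGraph n) (opposite Fin.zero)) (opposite-calls l) (alwaysLegal p′)
    wins : ∀ ps → Play (pathGraph n) centre (m ∷ calls l) ps → VisitsEachOnce (pathGraph n) ps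
    wins (_ ∷ ps) (move D play) with reply D
    ... | inj₁ refl with refl ← play-unique p play =
      visitsEachOnce (¬Any⇒All¬ l c∉l ∷ l!) visited
      where
      visited : ∀ x → x ∈ centre ∷ l
      visited x with x ≟ centre
      ... | yes x≡c = here x≡c
      ... | no  x≢c = there (all x≢c)
    ... | inj₂ refl with refl ← play-unique p′
                                  (subst (λ S → Play (pathGraph n) (opposite Fin.zero) S ps) (sym (opposite-calls l)) play) =
      visitsEachOnce (¬Any⇒All¬ l′ c∉l′ ∷ Unique.map⁺ opposite-injective l!) visited
      where
      c∉l′ : centre ∉ l′
      c∉l′ c∈ with ∈-map⁻ opposite c∈
      ... | y , y∈l , c≡ = c∉l (subst (_∈ l) (opposite-centre (sym c≡)) y∈l)
      visited : ∀ x → x ∈ centre ∷ l′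
      visited x with x ≟ centre
      ... | yes x≡c = here x≡c
      ... | no  x≢c = there (opposite-∈ (all (x≢c ∘ opposite-centre)))

-- Odd order: the other starts, and the conclusion.

odd-right : ∀ m (0<m : 0 < m) (v : Fin (suc (m + m))) → m < toℕ v → ∃[ z ] Hamiltonian v z
odd-right (suc k) 0<m v m<v with m≤n⇒m<n∨m≡n (s≤s⁻¹ (toℕ<n v))
-- From the right end, the mirrored zigzag is used, with the centre last.
... | inj₂ v≡2m = subst (λ x → ∃[ z ] Hamiltonian x z) opposite-zero (_ , opposite-ham (finish (proj₂ from-zero)))
  where
  open Odd (suc k) 0<m
  opposite-zero : opposite Fin.zero ≡ v
  opposite-zero = toℕ-injective (trans (trans (sym (+-identityʳ _)) (opposite-sum-2m Fin.zero)) (sym v≡2m))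
odd-right (suc zero) _ v 1<v | inj₁ v<2 = contradiction 1<v (<⇒≱ v<2)
-- Removing the centre turns `v` into `u` = v - 1, which lies in the range of `ham-to-last`;
-- reinserting it moves the last vertex to `end`.
odd-right (suc (suc k)) 0<m (Fin.suc u) m<v | inj₁ v<2m =
  subst (λ x → ∃[ z ] Hamiltonian x z) punchIn-u
    (_ , finish (proj₂ (punchIn-avoiding (ham-to-last k u m≤u u≤2k) punchIn-last)))
  where
  open Odd (suc (suc k)) 0<m
  m≤u : suc (suc k) ≤ toℕ u
  m≤u = s≤s⁻¹ m<v
  u≤2k : toℕ u ≤ suc k + suc k
  u≤2k = s≤s⁻¹ (≤-trans (s≤s⁻¹ v<2m) (≤-reflexive (+-suc (suc k) (suc k))))
  punchIn-u : punchIn centre u ≡ Fin.suc u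
  punchIn-u = toℕ-injective (toℕ-punchIn-≥ centre u (subst (_≤ toℕ u) (sym toℕ-centre) m≤u))
  toℕ-last : toℕ (Even.last (suc k) z<s) ≡ suc (suc k) + suc k
  toℕ-last = Even.toℕ-last (suc k) z<s
  punchIn-last : punchIn centre (Even.last (suc k) z<s) ≡ end
  punchIn-last = toℕ-injective (trans
    (toℕ-punchIn-≥ centre _ (subst₂ _≤_ (sym toℕ-centre) (sym toℕ-last) (m≤m+n (suc (suc k)) (suc k))))
    (trans (cong suc toℕ-last) (trans (sym (+-suc (suc (suc k)) (suc k))) (sym toℕ-end))))

odd : ∀ m (v : Fin (suc (m + m))) → ∃[ S ] Winning (suc (m + m)) v S
odd zero    Fin.zero = ham⇒winning ham₁
  where
  ham₁ : Hamiltonian {1} Fin.zero Fin.zero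
  ham₁ = _ , [ Fin.zero ] , All.[] ∷ [] , λ { Fin.zero → here refl }
odd (suc k) v with <-cmp (toℕ v) (suc k)
... | tri> _ _ m<v = ham⇒winning (proj₂ (odd-right (suc k) z<s v m<v))
... | tri≈ _ v≡m _ = subst (λ x → ∃[ S ] Winning _ x S) (toℕ-injective (trans toℕ-centre (sym v≡m))) centre-start
  where open Odd (suc k) z<s
-- The mirror image of `v` lies right of the centre, and its path is mirrored back.
... | tri< v<m _ _ = ham⇒winning (proj₂ (subst (λ x → ∃[ z ] Hamiltonian x z) (opposite-involutive v)
                       (_ , opposite-ham (proj₂ (odd-right (suc k) z<s (opposite v) m<v′)))))
  where
  m<v′ : suc k < toℕ (opposite v)
  m<v′ = ≰⇒> λ v′≤m → <⇒≢ (+-mono-≤-< v′≤m v<m) (Odd.opposite-sum-2m (suc k) z<s v)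

theorem4p4 : ∀ (n : ℕ) (v : Vertex (pathGraph n)) →
    ∃[ S ] (AlwaysLegal (pathGraph n) v S ×
    (∀ (ps : List (Vertex (pathGraph n))) → Play (pathGraph n) v S ps →
    VisitsEachOnce (pathGraph n) ps))
theorem4p4 n v with halve n
... | m , inj₁ refl = ham⇒winning (proj₂ (even m v))
... | m , inj₂ refl = odd m v
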